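{- Let $n,a,b,k$ be positive integers. If $b\ge n-k$, then Breaker has a winning strategy in the $(a:b)$ minimum-degree-$k$ Maker-Breaker game on $K_n$ in which Breaker moves first.
   Context: The $(a:b)$ minimum-degree-$k$ Maker-Breaker game on $K_n$: the board is the edge set of the complete graph $K_n$ on $n$ vertices. In each round Breaker first claims $b$ previously unclaimed edges, then Maker claims $a$ previously unclaimed edges (if fewer edges remain, a player claims all remaining ones). Maker wins if at the end of the game his edges form a spanning subgraph of minimum degree at least $k$; otherwise Breaker wins. -}

module Defs where

open import Data.Fin.Base using (Fin; _<_)
open import Data.Fin.Properties using (_≟_)
open import Data.List.Base using (List; []; _++_; length; filter; allFin)
open import Data.List.Membership.Propositional using (_∈_; _∉_)
open import Data.List.Relation.Unary.All using (All)
open import Data.List.Relation.Unary.Any using (Any; any?)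
open import Data.List.Relation.Unary.Unique.Propositional using (Unique)
import Data.Nat.Base as ℕ
open import Data.Nat.Base using (ℕ; zero; suc)
open import Data.Product.Base using (Σ-syntax; ∃-syntax; _×_)
open import Data.Sum.Base using (_⊎_)
open import Relation.Binary.PropositionalEquality.Core using (_≡_)
open import Relation.Nullary using (¬_; Dec; _×-dec_; _⊎-dec_)

-- An edge of K_n, i.e. an unordered pair of distinct vertices, is represented
-- by its increasing ordering.
record Edge (n : ℕ) : Set where
  constructor edge
  field
    lo hi : Fin n
    lo<hi : lo < hi

open Edge public

Joins : ∀ {n} → Fin n → Fin n → Edge n → Set
Joins v w e = (lo e ≡ v × hi e ≡ w) ⊎ (lo e ≡ w × hi e ≡ v)

joins? : ∀ {n} (v w : Fin n) (e : Edge n) → Dec (Joins v w e)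
joins? v w e = (lo e ≟ v ×-dec hi e ≟ w) ⊎-dec (lo e ≟ w ×-dec hi e ≟ v)

-- A list of edges stands for the spanning subgraph of K_n with those edges;
-- order and repetitions do not affect adjacency or degrees.
Adjacent : ∀ {n} → List (Edge n) → Fin n → Fin n → Set
Adjacent G v w = Any (Joins v w) G

adjacent? : ∀ {n} (G : List (Edge n)) (v w : Fin n) → Dec (Adjacent G v w)
adjacent? G v w = any? (joins? v w) G

degree : ∀ {n} → List (Edge n) → Fin n → ℕ
degree {n} G v = length (filter (adjacent? G v) (allFin n))

MinDegreeAtLeast : ∀ {n} → ℕ → List (Edge n) → Set
MinDegreeAtLeast {n} k G = (v : Fin n) → k ℕ.≤ degree G v

-- The edges claimed so far by each player, most recent first.  A position thus
-- also records the order of the claims, so a strategy may depend on the history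
-- of the play.
record Position (n : ℕ) : Set where
  constructor position
  field
    maker breaker : List (Edge n)

open Position public

start : ∀ {n} → Position n
start = position [] []

Free : ∀ {n} → Position n → Edge n → Set
Free p e = e ∉ maker p × e ∉ breaker p

Over : ∀ {n} → Position n → Set
Over {n} p = (e : Edge n) → ¬ Free p e

-- Claiming q distinct free edges, or all free edges if fewer than q remain.
Legal : ∀ {n} → ℕ → Position n → List (Edge n) → Set
Legal {n} q p M =
  Unique M × All (Free p) M ×
  (length M ≡ q ⊎ (length M ℕ.< q × ((e : Edge n) → Free p e → e ∈ M)))

record Strategy (n q : ℕ) : Set where
  field
    move  : Position n → List (Edge n)
    legal : (p : Position n) → Legal q p (move p)

open Strategy public

breakerMove : ∀ {n b} → Strategy n b → Position n → Position n
breakerMove σ p = position (maker p) (move σ p ++ breaker p)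

makerMove : ∀ {n a} → Strategy n a → Position n → Position n
makerMove τ p = position (move τ p ++ maker p) (breaker p)

-- The position after t full rounds; once the board is exhausted the only legal
-- move is [], so the position no longer changes.
play : ∀ {n a b} → Strategy n b → Strategy n a → ℕ → Position n
play σ τ zero    = start
play σ τ (suc t) = makerMove τ (breakerMove σ (play σ τ t))

BreakerWinsAgainst : ∀ {n a b} → ℕ → Strategy n b → Strategy n a → Set
BreakerWinsAgainst k σ τ =
  ∃[ t ] (Over (play σ τ t) × ¬ MinDegreeAtLeast k (maker (play σ τ t)))

BreakerHasWinningStrategy : (n a b k : ℕ) → Set
BreakerHasWinningStrategy n a b k =
  Σ[ σ ∈ Strategy n b ] ((τ : Strategy n a) → BreakerWinsAgainst k σ τ)

{-# OPTIONS --safe #-}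

-- Breaker always claims the first b free edges in the lexicographic order, so
-- his opening move consists of min(b, n − 1) edges at the vertex 0.  At the end
-- of the game the Maker-neighbours of 0 are therefore among the vertices
-- b + 1, …, n − 1, and there are max(n − 1 − b, 0) < k of these.
module Submission where

open import Data.Fin.Base using (Fin; zero; suc; toℕ)
import Data.Fin.Properties as Fin
open import Data.List.Base
  using (List; []; _∷_; _++_; length; filter; map; take; tabulate)
open import Data.List.Membership.Propositional using (_∈_; find)
open import Data.List.Membership.Propositional.Properties
  using (∈-++⁺ˡ; ∈-++⁺ʳ; ∈-++⁻; ∈-map⁺; ∈-map⁻; ∈-tabulate⁺; ∈-tabulate⁻; ∈-filter⁺)
open import Data.List.Properties
  using (length-++; length-filter; length-tabulate; length-take; take-all;
         filter-all; filter-notAll; filter-reject)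
open import Data.List.Relation.Binary.Disjoint.Propositional using (Disjoint)
open import Data.List.Relation.Binary.Subset.Propositional using (_⊆_)
open import Data.List.Relation.Unary.All as All using (All)
import Data.List.Relation.Unary.All.Properties as All
open import Data.List.Relation.Unary.AllPairs using ([]; _∷_)
open import Data.List.Relation.Unary.Any as Any using (here; there)
open import Data.List.Relation.Unary.Unique.Propositional using (Unique)
import Data.List.Relation.Unary.Unique.Propositional.Properties as Unique
open import Data.Nat.Base
  using (ℕ; zero; suc; NonZero; _+_; _∸_; _≤_; _<_; _≥_; z≤n; s≤s; s<s;
         >-nonZero⁻¹)
open import Data.Nat.Properties
open import Data.Product.Base using (_×_; _,_; proj₁; proj₂)
open import Data.Sum.Base using (_⊎_; inj₁; inj₂)
open import Function.Base using (_∘_; id)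
open import Level using (Level)
open import Relation.Binary.Definitions using (DecidableEquality)
open import Relation.Binary.PropositionalEquality
  using (_≡_; refl; trans; cong; subst)
open import Relation.Nullary
  using (yes; no; ¬_; ¬?; _×-dec_; contradiction)
open import Relation.Nullary.Decidable using (map′)
open import Relation.Unary using (Pred; Decidable)

open import Defs

private
  variable
    ℓ p : Level
    A : Set ℓ
    n a b : ℕ

-- Pigeonhole, by induction on `xs`: filtering the head out of `ys` makes `ys` strictly shorter, and
-- it keeps every element of the tail, since these all differ from the head.
unique-⊆⇒length≤ : DecidableEquality A → {xs ys : List A} →
  Unique xs → xs ⊆ ys → length xs ≤ length ys
unique-⊆⇒length≤ _≟_ [] _ = z≤n
unique-⊆⇒length≤ _≟_ {x ∷ _} {ys} (x∉xs ∷ xs!) xs⊆ys = ≤-trans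
  (s≤s (unique-⊆⇒length≤ _≟_ xs!
    (λ z∈xs → ∈-filter⁺ ≢x? (xs⊆ys (there z∈xs)) (All.lookup x∉xs z∈xs))))
  (filter-notAll ≢x? ys (Any.map (λ x≡y x≢y → x≢y x≡y) (xs⊆ys (here refl))))
  where
  ≢x? : Decidable (λ y → ¬ x ≡ y)
  ≢x? y = ¬? (x ≟ y)

∈-take-tabulate : (f : Fin n → A) (ys : List A) {m : ℕ} (i : Fin n) →
  toℕ i < m → f i ∈ take m (tabulate f ++ ys)
∈-take-tabulate f ys zero    (s≤s _)   = here refl
∈-take-tabulate f ys (suc i) (s<s i<m) =
  there (∈-take-tabulate (f ∘ suc) ys i i<m)

-- The first `c` entries fail `P`, and the induction drops them one by one. When `c` exceeds `n`
-- nothing survives, in agreement with truncated subtraction.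
length-filter-tabulate : {P : Pred A p} (P? : Decidable P) (f : Fin n → A) (c : ℕ) →
  (∀ i → P (f i) → c ≤ toℕ i) → length (filter P? (tabulate f)) ≤ n ∸ c
length-filter-tabulate P? f zero _ =
  ≤-trans (length-filter P? (tabulate f)) (≤-reflexive (length-tabulate f))
length-filter-tabulate {n = zero}  P? f (suc c) _ = z≤n
length-filter-tabulate {n = suc n} P? f (suc c) h
  rewrite filter-reject P? {xs = tabulate (f ∘ suc)} (λ Pf0 → n≮0 (h zero Pf0)) =
  length-filter-tabulate P? (f ∘ suc) c (λ i Pfi → ≤-pred (h (suc i) Pfi))

edge-≡ : {e f : Edge n} → lo e ≡ lo f → hi e ≡ hi f → e ≡ f
edge-≡ {e = edge l h p} {edge _ _ q} refl refl = cong (edge l h) (<-irrelevant p q)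

_≟ᴱ_ : DecidableEquality (Edge n)
e ≟ᴱ f = map′ (λ (l , h) → edge-≡ l h) (λ e≡f → cong lo e≡f , cong hi e≡f)
  (lo e Fin.≟ lo f ×-dec hi e Fin.≟ hi f)

spoke : Fin n → Edge (suc n)
spoke i = edge zero (suc i) (s≤s z≤n)

shift : Edge n → Edge (suc n)
shift (edge l h l<h) = edge (suc l) (suc h) (s<s l<h)

edges : ∀ n → List (Edge n)
edges zero    = []
edges (suc n) = tabulate spoke ++ map shift (edges n)

∈-edges : (e : Edge n) → e ∈ edges n
∈-edges {suc n} (edge zero    (suc h) _) =
  -- The given edge and `spoke h` may carry different proofs of `lo < hi`.
  subst (_∈ edges (suc n)) (edge-≡ refl refl) (∈-++⁺ˡ (∈-tabulate⁺ {f = spoke} h))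
∈-edges {suc n} (edge (suc l) (suc h) (s<s l<h)) =
  ∈-++⁺ʳ (tabulate spoke) (∈-map⁺ shift (∈-edges (edge l h l<h)))

edges-unique : ∀ n → Unique (edges n)
edges-unique zero    = []
edges-unique (suc n) = Unique.++⁺
  (Unique.tabulate⁺ (Fin.suc-injective ∘ cong hi))
  (Unique.map⁺ shift-injective (edges-unique n))
  disjoint
  where
  shift-injective : {e f : Edge n} → shift e ≡ shift f → e ≡ f
  shift-injective eq =
    edge-≡ (Fin.suc-injective (cong lo eq)) (Fin.suc-injective (cong hi eq))

  disjoint : Disjoint (tabulate spoke) (map shift (edges n))
  disjoint (e∈spokes , e∈shifts)
    with _ , refl ← ∈-tabulate⁻ {f = spoke} e∈spokes
    with _ , _ , () ← ∈-map⁻ shift e∈shifts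

free? : (p : Position n) → Decidable (Free p)
free? p e = ¬? (e ∈? maker p) ×-dec ¬? (e ∈? breaker p)
  where open import Data.List.Membership.DecPropositional _≟ᴱ_ using (_∈?_)

freeEdges : Position n → List (Edge n)
freeEdges p = filter (free? p) (edges _)

lexicographic : Strategy n b
lexicographic {b = b} .move p = take b (freeEdges p)
lexicographic {b = b} .legal p =
  Unique.take⁺ b (Unique.filter⁺ (free? p) (edges-unique _)) ,
  All.take⁺ b (All.all-filter (free? p) (edges _)) ,
  size
  where
  size : length (take b (freeEdges p)) ≡ b ⊎
         (length (take b (freeEdges p)) < b ×
          (∀ e → Free p e → e ∈ take b (freeEdges p)))
  size with b ≤? length (freeEdges p)
  ... | yes b≤ = inj₁ (trans (length-take b _) (m≤n⇒m⊓n≡m b≤))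
  -- With fewer than `b` free edges, `take b` cuts nothing off, so the move exhausts the board.
  ... | no  b≰ rewrite take-all b (freeEdges p) (<⇒≤ (≰⇒> b≰)) =
    inj₂ (≰⇒> b≰ , λ e → ∈-filter⁺ (free? p) (∈-edges e))

module _ (σ : Strategy n b) (τ : Strategy n a) where

  private
    pos : ℕ → Position n
    pos = play σ τ

    mid : ℕ → Position n
    mid t = breakerMove σ (pos t)

  disjoint-breakerMove : (p : Position n) → Disjoint (maker p) (breaker p) →
    Disjoint (maker p) (breaker (breakerMove σ p))
  disjoint-breakerMove p d (e∈M , e∈B) with ∈-++⁻ (move σ p) e∈B
  ... | inj₁ e∈σ = proj₁ (All.lookup (proj₁ (proj₂ (legal σ p))) e∈σ) e∈M
  ... | inj₂ e∈B = d (e∈M , e∈B)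

  disjoint-makerMove : (p : Position n) → Disjoint (maker p) (breaker p) →
    Disjoint (maker (makerMove τ p)) (breaker p)
  disjoint-makerMove p d (e∈M , e∈B) with ∈-++⁻ (move τ p) e∈M
  ... | inj₁ e∈τ = proj₂ (All.lookup (proj₁ (proj₂ (legal τ p))) e∈τ) e∈B
  ... | inj₂ e∈M = d (e∈M , e∈B)

  play-disjoint : ∀ t → Disjoint (maker (pos t)) (breaker (pos t))
  play-disjoint zero    (() , _)
  play-disjoint (suc t) =
    disjoint-makerMove (mid t) (disjoint-breakerMove (pos t) (play-disjoint t))

  breaker-unique : ∀ t → Unique (breaker (pos t))
  breaker-unique zero    = []
  breaker-unique (suc t) = Unique.++⁺ (proj₁ (legal σ (pos t))) (breaker-unique t)
    (λ (e∈σ , e∈B) → proj₂ (All.lookup (proj₁ (proj₂ (legal σ (pos t)))) e∈σ) e∈B)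

  opening-kept : ∀ t → move σ start ⊆ breaker (pos (suc t))
  opening-kept zero    = ∈-++⁺ˡ
  opening-kept (suc t) = ∈-++⁺ʳ (move σ (pos (suc t))) ∘ opening-kept t

  free-before : ∀ t {e} → Free (pos (suc t)) e → Free (pos t) e
  free-before t (e∉M , e∉B) =
    e∉M ∘ ∈-++⁺ʳ (move τ (mid t)) , e∉B ∘ ∈-++⁺ʳ (move σ (pos t))

  -- Termination measured by Breaker's claims alone: a full move adds `b ≥ 1` edges to his list,
  -- while a short move takes every free edge and so ends the game.
  over-or-long : .{{NonZero b}} → ∀ t → Over (pos t) ⊎ t ≤ length (breaker (pos t))
  over-or-long zero = inj₂ z≤n
  over-or-long (suc t) with over-or-long t
  ... | inj₁ over = inj₁ (λ e → over e ∘ free-before t)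
  ... | inj₂ t≤ with proj₂ (proj₂ (legal σ (pos t)))
  ...   | inj₂ (_ , all) = inj₁ λ e free →
    proj₂ free (∈-++⁺ˡ (all e (free-before t free)))
  ...   | inj₁ ≡b = inj₂ (begin
    1 + t                                               ≤⟨ +-mono-≤ (>-nonZero⁻¹ b) t≤ ⟩
    b + length (breaker (pos t))                        ≡⟨ cong (_+ length (breaker (pos t))) ≡b ⟨
    length (move σ (pos t)) + length (breaker (pos t))  ≡⟨ length-++ (move σ (pos t)) ⟨
    length (breaker (pos (suc t)))                      ∎)
    where open ≤-Reasoning

  -- After one round more than there are edges, an unfinished game would give Breaker more distinct
  -- edges than the board has.
  play-over : .{{NonZero b}} → Over (pos (suc (length (edges n))))
  play-over with over-or-long (suc (length (edges n)))
  ... | inj₁ over = over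
  ... | inj₂ long = contradiction
    (≤-trans long (unique-⊆⇒length≤ _≟ᴱ_ (breaker-unique (suc (length (edges n))))
      (λ {e} _ → ∈-edges e)))
    1+n≰n

spoke∈opening : (i : Fin n) → toℕ i < b →
  spoke i ∈ move (lexicographic {b = b}) start
spoke∈opening {n} {b} i i<b
  -- At the start every edge is free, so `freeEdges` is all of `edges (suc n)`, which begins with
  -- the spokes.
  rewrite filter-all (free? (start {suc n}))
            (All.universal (λ _ → (λ ()) , λ ()) (edges (suc n))) =
  ∈-take-tabulate spoke (map shift (edges n)) i i<b

-- The reversed orientation would put a vertex below `zero`.
joins-zero : {i : Fin n} {e : Edge (suc n)} → Joins zero (suc i) e → e ≡ spoke i
joins-zero (inj₁ (lo≡ , hi≡)) = edge-≡ lo≡ hi≡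
joins-zero {e = edge _ _ ()} (inj₂ (_ , refl))

-- The round count `suc t` ensures that Breaker's opening has been played.
maker-degree-zero : (τ : Strategy (suc n) a) (t : ℕ) →
  degree (maker (play (lexicographic {b = b}) τ (suc t))) zero ≤ n ∸ b
maker-degree-zero {n} {b = b} τ t =
  -- The cutoff is `suc b` because vertex 0 itself is excluded along with the vertices 1 to `b`;
  -- then `suc n ∸ suc b` reduces to `n ∸ b`.
  length-filter-tabulate (adjacent? G zero) id (suc b) far
  where
  σ = lexicographic {b = b}
  G = maker (play σ τ (suc t))

  far : (w : Fin (suc n)) → Adjacent G zero w → b < toℕ w
  far w adj with find adj
  far zero    _ | e , _ , inj₁ (refl , refl) = contradiction (lo<hi e) n≮0
  far zero    _ | e , _ , inj₂ (refl , refl) = contradiction (lo<hi e) n≮0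
  -- If `i < b`, Maker's edge `e` would be `spoke i`, which Breaker took in his opening and still
  -- holds.
  far (suc i) _ | e , e∈G , joins = s≤s (≮⇒≥ λ i<b →
    play-disjoint σ τ (suc t)
      ( subst (_∈ G) (joins-zero {e = e} joins) e∈G
      , opening-kept σ τ t (spoke∈opening i i<b)))

-- Writing `k` as `suc k`, hypothesis and conclusion both amount to `m ≤ b + k`.
∸-flip-< : ∀ m b k → .{{NonZero k}} → suc m ∸ k ≤ b → m ∸ b < k
∸-flip-< m b (suc k) m∸k≤b =
  s≤s (m≤n+o⇒m∸n≤o m b (begin
    m            ≤⟨ m≤n+m∸n m k ⟩
    k + (m ∸ k)  ≤⟨ +-monoʳ-≤ k m∸k≤b ⟩
    k + b        ≡⟨ +-comm k b ⟩
    b + k        ∎))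
  where open ≤-Reasoning

theorem13 : (n a b k : ℕ) → .{{ _ : NonZero n }} → .{{ _ : NonZero a }} →
    .{{ _ : NonZero b }} → .{{ _ : NonZero k }} →
    b ≥ n ∸ k → BreakerHasWinningStrategy n a b k
theorem13 (suc n) a b k n∸k≤b = lexicographic , λ τ →
  suc (length (edges (suc n))) , play-over lexicographic τ , λ minDeg →
  -- Vertex 0 violates the degree condition. The board has `suc n` vertices, so its Maker-degree is
  -- at most `n ∸ b`, which is below `k`.
  <⇒≱ (∸-flip-< n b k n∸k≤b)
    (≤-trans (minDeg zero) (maker-degree-zero {b = b} τ (length (edges (suc n)))))
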